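{- Let $n\ge1$ be an integer, let $a_0$, $\rho\ne0$, $\alpha$, $\beta$ be complex parameters with $\beta\notin\{0,-1,-2,\dots\}$, and let $$a_m=a_0\,\rho^m\,\frac{(\alpha)_m}{(\beta)_m}\qquad(m\ge0).$$ Let $0\le x_0<x_1<\dots<x_{n-1}$ be integers. Then $$\det\bigl(a_{x_i+j}\bigr)_{0\le i,j\le n-1} =\rho^{\binom n2}\,\prod_{i=0}^{n-1}(\beta-\alpha)_i\; \prod_{0\le i<j\le n-1}(x_j-x_i)\; \prod_{i=0}^{n-1}\frac{a_{x_i}}{(x_i+\beta)_{n-1}}.$$
   Context: $(\gamma)_m=\gamma(\gamma+1)\cdots(\gamma+m-1)$ is the Pochhammer symbol, with $(\gamma)_0=1$; empty products equal $1$. -}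

module Defs where

open import Algebra.Apartness.Bundles using (HeytingField; module HeytingCommutativeRing)
import Algebra.Apartness.Properties.HeytingCommutativeRing
open import Algebra.Bundles using (module CommutativeRing; module Semiring)
import Algebra.Definitions.RawSemiring
import Algebra.Properties.Monoid.Mult
import Algebra.Properties.Ring
open import Data.Fin.Base using (Fin; zero; suc; toℕ)
open import Data.Nat.Base as ℕ using (ℕ; zero; suc)
open import Data.Product.Base using (_,_; proj₁)
open import Data.Vec.Functional using (removeAt)

-- The library has no complex numbers, so the field is arbitrary. x # y is the
-- positive form of x ≠ y: it holds exactly when x - y is invertible.
module Over {c ℓ₁ ℓ₂} (F : HeytingField c ℓ₁ ℓ₂) where

  open HeytingField F hiding (zero)
  open HeytingCommutativeRing heytingCommutativeRing using (commutativeRing)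
  open CommutativeRing commutativeRing using (ring; semiring; +-monoid)
  open Algebra.Apartness.Properties.HeytingCommutativeRing heytingCommutativeRing
    using (1#0; x#0y#0→xy#0; x-0≈x; #-congʳ)
  open Algebra.Properties.Ring ring using (-‿involutive)
  open Algebra.Properties.Monoid.Mult +-monoid using (×-homo-+)

  open Algebra.Definitions.RawSemiring
    (Semiring.rawSemiring semiring) public
    using (_×_; _^_) renaming (sum to ∑; product to ∏)

  fromℕ : ℕ → Carrier
  fromℕ m = m × 1#

  infixl 7 _/_[_]

  -- #⇒invertible y#0 inverts y - 0#, which is ≈ y.
  _/_[_] : (x y : Carrier) → y # 0# → Carrier
  x / y [ y#0 ] = x * proj₁ (#⇒invertible y#0)

  pochhammer : Carrier → ℕ → Carrier
  pochhammer γ zero    = 1#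
  pochhammer γ (suc m) = pochhammer γ m * (γ + fromℕ m)

  -- γ ∉ {0, -1, -2, …}
  NotNonPositiveInteger : Carrier → Set ℓ₂
  NotNonPositiveInteger γ = ∀ k → γ # (- fromℕ k)

  -- Cofactor expansion along row 0, hence the sign (-1)^j.
  det : ∀ {n} → (Fin n → Fin n → Carrier) → Carrier
  det {zero}  A = 1#
  det {suc n} A =
    ∑ λ j → (- 1#) ^ toℕ j * A zero j * det (λ i → removeAt (A (suc i)) j)

  x#-y⇒x+y#0 : ∀ {x y} → x # (- y) → x + y # 0#
  x#-y⇒x+y#0 {x} {y} x#-y with #⇒invertible x#-y
  ... | inv , l , r =
    invertible⇒# (inv , trans (*-congˡ eq) l , trans (*-congʳ eq) r)
    where
    eq : (x + y) - 0# ≈ x - (- y)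
    eq = trans (x-0≈x (x + y)) (+-congˡ (sym (-‿involutive y)))

  x+y#0⇒x#-y : ∀ {x y} → x + y # 0# → x # (- y)
  x+y#0⇒x#-y {x} {y} x+y#0 with #⇒invertible x+y#0
  ... | inv , l , r =
    invertible⇒# (inv , trans (*-congˡ eq) l , trans (*-congʳ eq) r)
    where
    eq : x - (- y) ≈ (x + y) - 0#
    eq = trans (+-congˡ (-‿involutive y)) (sym (x-0≈x (x + y)))

  pochhammer#0 : ∀ {γ} → NotNonPositiveInteger γ → ∀ m → pochhammer γ m # 0#
  pochhammer#0 γ∉ zero    = 1#0
  pochhammer#0 γ∉ (suc m) = x#0y#0→xy#0 (pochhammer#0 γ∉ m) (x#-y⇒x+y#0 (γ∉ m))

  shift∉ : ∀ {γ} → NotNonPositiveInteger γ →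
           ∀ m → NotNonPositiveInteger (fromℕ m + γ)
  shift∉ {γ} γ∉ m k = x+y#0⇒x#-y (#-congʳ eq (x#-y⇒x+y#0 (γ∉ (m ℕ.+ k))))
    where
    eq : γ + fromℕ (m ℕ.+ k) ≈ (fromℕ m + γ) + fromℕ k
    eq = trans (+-congˡ (×-homo-+ 1# m k))
        (trans (sym (+-assoc γ (fromℕ m) (fromℕ k)))
               (+-congʳ (+-comm γ (fromℕ m))))

{-# OPTIONS --safe #-}

-- Write a_{x+j} = a_x ρʲ (α+x)ⱼ/(β+x)ⱼ and pull out a_x and ρʲ. In the
-- remaining matrix, with aᵢ = xᵢ + α and bᵢ = xᵢ + β, subtract
-- (a₀+k)/(b₀+k) times column k from column k+1. This clears the top row
-- except for its first entry 1, and since bᵢ - aᵢ = δ does not depend on i,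
-- entry (i , k+1) becomes
--   (bᵢ-b₀)/bᵢ · δ/(b₀+k) · (aᵢ)ₖ/(1+bᵢ)ₖ.
-- Up to row and column factors the minor is thus the same matrix of size n-1
-- for the parameters aᵢ, 1+bᵢ and 1+δ.
module Submission where

open import Defs
open import Algebra.Apartness.Bundles using (HeytingField; module HeytingCommutativeRing)
import Algebra.Apartness.Properties.HeytingCommutativeRing
open import Algebra.Bundles using (module CommutativeRing)
import Algebra.Properties.CommutativeMonoid.Sum
import Algebra.Properties.Monoid.Mult
import Algebra.Properties.Ring
import Algebra.Properties.Semiring.Exp
import Algebra.Properties.Semiring.Sum
import Algebra.Solver.Ring.NaturalCoefficients.Default
open import Data.Fin.Base as Fin
  using (Fin; Fin′; zero; suc; toℕ; inject; inject₁; punchIn; punchOut)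
open import Data.Fin.Induction using (>-weakInduction)
open import Data.Fin.Properties
  using (_≟_; suc-injective; punchInᵢ≢i; punchIn-punchOut; punchOut-punchIn; punchOut-cong;
         toℕ-inject₁; toℕ-fromℕ; toℕ<n; toℕ-injective)
open import Data.Nat.Base as ℕ using (ℕ; zero; suc)
open import Data.Nat.Combinatorics using (_C_; nC1≡n; nCk+nC[k+1]≡[n+1]C[k+1])
import Data.Nat.Properties as ℕ
open import Data.Product.Base using (proj₁; proj₂)
open import Data.Vec.Functional using (removeAt; updateAt)
open import Data.Vec.Functional.Properties using (updateAt-updates; updateAt-minimal)
open import Function.Base using (_∘_; const)
open import Relation.Binary.PropositionalEquality as ≡ using (_≡_; _≢_)
import Relation.Binary.Reasoning.Setoid
open import Relation.Nullary using (yes; no; contradiction)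

-- Adjacent column indices and the deletion of a column.

-- Inductive rather than an equation between `toℕ p` and `toℕ q`, so that facts about `punchIn`,
-- `punchOut` and sums recurse along it.
data Adjacent : ∀ {n} → Fin n → Fin n → Set where
  here  : ∀ {n} → Adjacent {suc (suc n)} zero (suc zero)
  there : ∀ {n} {p q : Fin n} → Adjacent p q → Adjacent (suc p) (suc q)

adjacent-inject₁-suc : ∀ {n} (k : Fin n) → Adjacent (inject₁ k) (suc k)
adjacent-inject₁-suc zero    = here
adjacent-inject₁-suc (suc k) = there (adjacent-inject₁-suc k)

adjacent⇒≢ : ∀ {n} {p q : Fin n} → Adjacent p q → p ≢ q
adjacent⇒≢ (there a) = adjacent⇒≢ a ∘ suc-injective

adjacent-toℕ : ∀ {n} {p q : Fin n} → Adjacent p q → toℕ q ≡ suc (toℕ p)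
adjacent-toℕ here      = ≡.refl
adjacent-toℕ (there a) = ≡.cong suc (adjacent-toℕ a)

-- No index lies strictly between `p` and `q`, so deleting a third index `j` shifts both of them or
-- neither.
adjacent-punchOut : ∀ {n} {j p q : Fin (suc n)} → Adjacent p q →
                    (j≢p : j ≢ p) (j≢q : j ≢ q) →
                    Adjacent (punchOut j≢p) (punchOut j≢q)
adjacent-punchOut {j = zero}  here      j≢p j≢q = contradiction ≡.refl j≢p
adjacent-punchOut {j = zero}  (there a) j≢p j≢q = a
adjacent-punchOut {j = suc zero} here   j≢p j≢q = contradiction ≡.refl j≢q
adjacent-punchOut {suc (suc n)} {suc (suc j)} here j≢p j≢q = here
adjacent-punchOut {suc n} {suc j} (there a) j≢p j≢q =
  there (adjacent-punchOut a (j≢p ∘ ≡.cong suc) (j≢q ∘ ≡.cong suc))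

-- Deleting `p` and deleting `q` have the same effect below and above the pair; they differ only at
-- the place where one leaves `q` and the other leaves `p`.
adjacent-punchIn : ∀ {n} {p q : Fin (suc n)} → Adjacent p q → ∀ i → punchIn p i ≢ q →
                   punchIn p i ≡ punchIn q i
adjacent-punchIn here      zero    ≢q = contradiction ≡.refl ≢q
adjacent-punchIn here      (suc i) ≢q = ≡.refl
adjacent-punchIn (there a) zero    ≢q = ≡.refl
adjacent-punchIn (there a) (suc i) ≢q = ≡.cong suc (adjacent-punchIn a i (≢q ∘ ≡.cong suc))

adjacent-punchIn-punchOut : ∀ {n} {p q : Fin (suc n)} → Adjacent p q → (p≢q : p ≢ q) →
                            punchIn q (punchOut p≢q) ≡ p
adjacent-punchIn-punchOut here p≢q = ≡.refl
adjacent-punchIn-punchOut {suc n} (there a) p≢q =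
  ≡.cong suc (adjacent-punchIn-punchOut a (p≢q ∘ ≡.cong suc))

n+nC2≡[1+n]C2 : ∀ n → n ℕ.+ n C 2 ≡ suc n C 2
n+nC2≡[1+n]C2 n =
  ≡.trans (≡.cong (ℕ._+ n C 2) (≡.sym (nC1≡n n))) (nCk+nC[k+1]≡[n+1]C[k+1] n 1)

module _ {c ℓ₁ ℓ₂} (F : HeytingField c ℓ₁ ℓ₂) where

  open HeytingField F hiding (zero)
  open Over F
  open HeytingCommutativeRing heytingCommutativeRing using (commutativeRing)
  open CommutativeRing commutativeRing
    using (ring; semiring; commutativeSemiring; +-monoid; *-commutativeMonoid)
  open Algebra.Apartness.Properties.HeytingCommutativeRing heytingCommutativeRing using (x-0≈x)
  open Algebra.Properties.Monoid.Mult +-monoid using (×-homo-+)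
  open Algebra.Properties.Ring ring using (-‿distribˡ-*; +-cancelʳ; x≈z//y; //-rightDividesˡ)
  open Algebra.Properties.Semiring.Exp semiring using (^-homo-*; ^-congʳ)
  open Algebra.Properties.Semiring.Sum semiring
    using (∑-distrib-+; *-distribˡ-sum; sum-replicate-zero) renaming (sum-cong-≋ to ∑-cong)
  open Algebra.Properties.CommutativeMonoid.Sum *-commutativeMonoid
    using ()
    renaming (sum-cong-≋ to ∏-cong; ∑-distrib-+ to ∏-distrib-*;
              sum-remove to ∏-remove; sum-init-last to ∏-init-last)
  open Algebra.Solver.Ring.NaturalCoefficients.Default commutativeSemiring
    using (solve; _:=_; _:+_; _:*_; con)
  open Relation.Binary.Reasoning.Setoid setoid

  -- Determinants: scaling and linearity in a column.

  Matrix : ℕ → Set c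
  Matrix n = Fin n → Fin n → Carrier

  minor : ∀ {n} → Matrix (suc n) → Fin (suc n) → Matrix n
  minor A j i = removeAt (A (suc i)) j

  sign : ∀ {n} → Fin n → Carrier
  sign j = (- 1#) ^ toℕ j

  cofactorTerm : ∀ {n} → Matrix (suc n) → Fin (suc n) → Carrier
  cofactorTerm A j = sign j * A zero j * det (minor A j)

  ≡⇒≈ : ∀ {x y} → x ≡ y → x ≈ y
  ≡⇒≈ ≡.refl = refl

  det-cong : ∀ {n} {A B : Matrix n} → (∀ i j → A i j ≈ B i j) → det A ≈ det B
  det-cong {zero}  A≈B = refl
  det-cong {suc n} A≈B = ∑-cong λ j →
    *-cong (*-congˡ {sign j} (A≈B zero j)) (det-cong λ i k → A≈B (suc i) (punchIn j k))

  -- In term `j` of the expansion the top row supplies `u zero` and `v j`, and by induction the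
  -- minor supplies all the other factors.
  det-scale : ∀ {n} (u v : Fin n → Carrier) (A : Matrix n) →
              det (λ i j → u i * (v j * A i j)) ≈ ∏ u * ∏ v * det A
  det-scale {zero}  u v A = sym (trans (*-identityʳ _) (*-identityʳ _))
  det-scale {suc n} u v A = begin
    det (λ i j → u i * (v j * A i j))      ≈⟨ ∑-cong term ⟩
    ∑ (λ j → ∏ u * ∏ v * cofactorTerm A j) ≈⟨ *-distribˡ-sum (∏ u * ∏ v) (cofactorTerm A) ⟨
    ∏ u * ∏ v * det A                      ∎
    where
    u′ = ∏ (λ i → u (suc i))
    term : ∀ j → cofactorTerm (λ i j → u i * (v j * A i j)) j ≈ ∏ u * ∏ v * cofactorTerm A j
    term j = begin
      sign j * (u zero * (v j * A zero j)) * det (minor (λ i j → u i * (v j * A i j)) j)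
        ≈⟨ *-congˡ (det-scale (u ∘ suc) (removeAt v j) (minor A j)) ⟩
      sign j * (u zero * (v j * A zero j)) * (u′ * ∏ (removeAt v j) * det (minor A j))
        ≈⟨ solve 7 (λ s u₀ vⱼ x u′ v′ d →
             s :* (u₀ :* (vⱼ :* x)) :* (u′ :* v′ :* d) :=
             u₀ :* u′ :* (vⱼ :* v′) :* (s :* x :* d)) refl _ _ _ _ _ _ _ ⟩
      u zero * u′ * (v j * ∏ (removeAt v j)) * cofactorTerm A j
        ≈⟨ *-congʳ (*-congˡ (∏-remove v)) ⟨
      ∏ u * ∏ v * cofactorTerm A j ∎

  -- Column `k` enters term `k` only through its top entry and every other term only through the
  -- minor. Describing `A`, `B` and `D` by entrywise hypotheses lets the minors satisfy the same
  -- hypotheses.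
  det-linear : ∀ {n} (k : Fin n) (A B D : Matrix n) t →
               (∀ i j → j ≢ k → D i j ≈ A i j) →
               (∀ i j → j ≢ k → D i j ≈ B i j) →
               (∀ i → D i k ≈ A i k + t * B i k) →
               det D ≈ det A + t * det B
  det-linear {suc n} k A B D t D≈A D≈B Dₖ = begin
    det D                                               ≈⟨ ∑-cong term ⟩
    ∑ (λ j → cofactorTerm A j + t * cofactorTerm B j)
      ≈⟨ ∑-distrib-+ (cofactorTerm A) (λ j → t * cofactorTerm B j) ⟩
    det A + ∑ (λ j → t * cofactorTerm B j)              ≈⟨ +-congˡ (*-distribˡ-sum t (cofactorTerm B)) ⟨
    det A + t * det B                                   ∎
    where
    term : ∀ j → cofactorTerm D j ≈ cofactorTerm A j + t * cofactorTerm B j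
    term j with j ≟ k
    ... | yes ≡.refl = begin
      sign j * D zero j * det (minor D j)
        ≈⟨ *-congʳ (*-congˡ (Dₖ zero)) ⟩
      sign j * (A zero j + t * B zero j) * det (minor D j)
        ≈⟨ solve 5 (λ s a t b d →
             s :* (a :+ t :* b) :* d := s :* a :* d :+ t :* (s :* b :* d)) refl _ _ _ _ _ ⟩
      sign j * A zero j * det (minor D j) + t * (sign j * B zero j * det (minor D j))
        ≈⟨ +-cong (*-congˡ (det-cong λ i l → D≈A (suc i) _ (punchInᵢ≢i j l)))
                  (*-congˡ (*-congˡ (det-cong λ i l → D≈B (suc i) _ (punchInᵢ≢i j l)))) ⟩
      cofactorTerm A j + t * cofactorTerm B j ∎
    ... | no j≢k = begin
      sign j * D zero j * det (minor D j)
        ≈⟨ *-congˡ (det-linear (punchOut j≢k) (minor A j) (minor B j) (minor D j) t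
             (λ i l l≢ → D≈A (suc i) _ (off l l≢))
             (λ i l l≢ → D≈B (suc i) _ (off l l≢))
             at) ⟩
      sign j * D zero j * (det (minor A j) + t * det (minor B j))
        ≈⟨ solve 5 (λ s x d t e →
             s :* x :* (d :+ t :* e) := s :* x :* d :+ t :* (s :* x :* e)) refl _ _ _ _ _ ⟩
      sign j * D zero j * det (minor A j) + t * (sign j * D zero j * det (minor B j))
        ≈⟨ +-cong (*-congʳ (*-congˡ (D≈A zero j j≢k)))
                  (*-congˡ (*-congʳ (*-congˡ (D≈B zero j j≢k)))) ⟩
      cofactorTerm A j + t * cofactorTerm B j ∎
      where
      off : ∀ l → l ≢ punchOut j≢k → punchIn j l ≢ k
      off l l≢ eq = l≢ (≡.trans (≡.sym (punchOut-punchIn j)) (punchOut-cong j eq))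
      at : ∀ i → minor D j i (punchOut j≢k) ≈
                 minor A j i (punchOut j≢k) + t * minor B j i (punchOut j≢k)
      at i rewrite punchIn-punchOut j≢k = Dₖ (suc i)

  -- Adding multiples of columns to their right neighbours.

  -- For expansions in which two neighbouring terms change individually while their sum is
  -- preserved.
  ∑-cong-adjacent : ∀ {n} {p q : Fin n} → Adjacent p q → {f g : Fin n → Carrier} →
                    (∀ j → j ≢ p → j ≢ q → f j ≈ g j) →
                    f p + f q ≈ g p + g q → ∑ f ≈ ∑ g
  ∑-cong-adjacent here {f} {g} f≈g eq = begin
    f zero + (f (suc zero) + ∑ (λ j → f (suc (suc j)))) ≈⟨ +-assoc _ _ _ ⟨
    f zero + f (suc zero) + ∑ (λ j → f (suc (suc j)))
      ≈⟨ +-cong eq (∑-cong λ j → f≈g (suc (suc j)) (λ ()) (λ ())) ⟩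
    g zero + g (suc zero) + ∑ (λ j → g (suc (suc j)))   ≈⟨ +-assoc _ _ _ ⟩
    ∑ g                                                 ∎
  ∑-cong-adjacent (there a) f≈g eq =
    +-cong (f≈g zero (λ ()) (λ ()))
      (∑-cong-adjacent a
        (λ j j≢p j≢q → f≈g (suc j) (j≢p ∘ suc-injective) (j≢q ∘ suc-injective)) eq)

  -- Terms p and q of the expansion change by opposite amounts: the minors of
  -- A at p and q differ only in that column q of A takes the place of column
  -- p, and their signs are opposite. No alternation property is needed.
  det-addColumn : ∀ {n} {p q : Fin n} → Adjacent p q → (A B : Matrix n) → ∀ t →
                  (∀ i j → j ≢ q → B i j ≈ A i j) →
                  (∀ i → B i q ≈ A i q + t * A i p) →
                  det B ≈ det A
  det-addColumn {suc n} {p} {q} p~q A B t B≈A Bq = ∑-cong-adjacent p~q other pair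
    where
    p≢q = adjacent⇒≢ p~q

    other : ∀ j → j ≢ p → j ≢ q → cofactorTerm B j ≈ cofactorTerm A j
    other j j≢p j≢q = *-cong (*-congˡ (B≈A zero j j≢q))
      (det-addColumn (adjacent-punchOut p~q j≢p j≢q) (minor A j) (minor B j) t off at)
      where
      off : ∀ i l → l ≢ punchOut j≢q → minor B j i l ≈ minor A j i l
      off i l l≢ = B≈A (suc i) _ λ eq →
        l≢ (≡.trans (≡.sym (punchOut-punchIn j)) (punchOut-cong j eq))
      at : ∀ i → minor B j i (punchOut j≢q) ≈
                 minor A j i (punchOut j≢q) + t * minor A j i (punchOut j≢p)
      at i rewrite punchIn-punchOut j≢q | punchIn-punchOut j≢p = Bq (suc i)

    minor-p : det (minor B p) ≈ det (minor A p) + t * det (minor A q)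
    minor-p = det-linear (punchOut p≢q) (minor A p) (minor A q) (minor B p) t
      (λ i l l≢ → B≈A (suc i) _ (≢q l l≢))
      (λ i l l≢ → trans (B≈A (suc i) _ (≢q l l≢))
        (≡⇒≈ (≡.cong (A (suc i)) (adjacent-punchIn p~q l (≢q l l≢)))))
      at
      where
      ≢q : ∀ l → l ≢ punchOut p≢q → punchIn p l ≢ q
      ≢q l l≢ eq = l≢ (≡.trans (≡.sym (punchOut-punchIn p)) (punchOut-cong p eq))
      at : ∀ i → minor B p i (punchOut p≢q) ≈
                 minor A p i (punchOut p≢q) + t * minor A q i (punchOut p≢q)
      at i rewrite punchIn-punchOut p≢q | adjacent-punchIn-punchOut p~q p≢q = Bq (suc i)

    minor-q : det (minor B q) ≈ det (minor A q)
    minor-q = det-cong λ i l → B≈A (suc i) _ (punchInᵢ≢i q l)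

    sign-q : sign q ≈ - 1# * sign p
    sign-q = ≡⇒≈ (≡.cong ((- 1#) ^_) (adjacent-toℕ p~q))

    pair : cofactorTerm B p + cofactorTerm B q ≈ cofactorTerm A p + cofactorTerm A q
    pair = begin
      cofactorTerm B p + cofactorTerm B q
        ≈⟨ +-cong (*-cong (*-congˡ (B≈A zero p p≢q)) minor-p)
                  (*-cong (*-cong sign-q (Bq zero)) minor-q) ⟩
      sign p * A zero p * (det (minor A p) + t * det (minor A q)) +
      - 1# * sign p * (A zero q + t * A zero p) * det (minor A q)
        -- The solver works over semirings, so `- 1#` enters as a variable `m`. The unwanted
        -- products collect into a multiple of `con 1 :+ m`, which vanishes in the next step.
        ≈⟨ solve 7 (λ s x y t d e m →
             s :* x :* (d :+ t :* e) :+ m :* s :* (y :+ t :* x) :* e :=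
             s :* x :* d :+ m :* s :* y :* e :+ (con 1 :+ m) :* (s :* t :* x :* e))
             refl (sign p) (A zero p) (A zero q) t (det (minor A p)) (det (minor A q)) (- 1#) ⟩
      cofactorTerm A p + - 1# * sign p * A zero q * det (minor A q) +
      (1# - 1#) * (sign p * t * A zero p * det (minor A q))
        ≈⟨ +-cong (+-congˡ (*-congʳ (*-congʳ (sym sign-q))))
             (trans (*-congʳ (-‿inverseʳ 1#)) (zeroˡ _)) ⟩
      cofactorTerm A p + cofactorTerm A q + 0# ≈⟨ +-identityʳ _ ⟩
      cofactorTerm A p + cofactorTerm A q ∎

  -- The product of `A` with a unit upper bidiagonal matrix whose superdiagonal is `t`.
  shear : ∀ {n} → (Fin n → Carrier) → Matrix (suc n) → Matrix (suc n)
  shear t A i zero    = A i zero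
  shear t A i (suc k) = A i (suc k) + t k * A i (inject₁ k)

  shear-fixes : ∀ {n} (t : Fin n → Carrier) (A : Matrix (suc n)) i j →
                (∀ k → suc k ≡ j → t k ≈ 0#) → shear t A i j ≈ A i j
  shear-fixes t A i zero    t≈0 = refl
  shear-fixes t A i (suc k) t≈0 =
    trans (+-congˡ (trans (*-congʳ (t≈0 k ≡.refl)) (zeroˡ _))) (+-identityʳ _)

  det-shear : ∀ {n} (t : Fin n → Carrier) (A : Matrix (suc n)) → det (shear t A) ≈ det A
  det-shear {n} t A = >-weakInduction P all-zero step zero t (λ k ())
    where
    -- Columns are treated from right to left, so that the column being added
    -- is still an original one.
    P : Fin (suc n) → Set _
    P m = ∀ t → (∀ k → toℕ k ℕ.< toℕ m → t k ≈ 0#) → det (shear t A) ≈ det A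

    all-zero : P (Fin.fromℕ n)
    all-zero t t≈0 = det-cong λ i j → shear-fixes t A i j λ k _ →
      t≈0 k (≡.subst (toℕ k ℕ.<_) (≡.sym (toℕ-fromℕ n)) (toℕ<n k))

    step : ∀ m → P (suc m) → P (inject₁ m)
    step m ih t t≈0 =
      trans (det-addColumn (adjacent-inject₁-suc m) (shear t′ A) (shear t A) (t m) off at)
            (ih t′ t′≈0)
      where
      -- With multiplier `m` switched off, `shear t′ A` differs from `shear t A` in column `suc m`
      -- only, and its columns `inject₁ m` and `suc m` are still those of `A`.
      t′ = updateAt t m (const 0#)

      t′≈0 : ∀ k → toℕ k ℕ.< suc (toℕ m) → t′ k ≈ 0#
      t′≈0 k k≤m with k ≟ m
      ... | yes ≡.refl = ≡⇒≈ (updateAt-updates k t)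
      ... | no k≢m = trans (≡⇒≈ (updateAt-minimal k m t k≢m))
        (t≈0 k (≡.subst (toℕ k ℕ.<_) (≡.sym (toℕ-inject₁ m))
          (ℕ.≤∧≢⇒< (ℕ.s≤s⁻¹ k≤m) (k≢m ∘ toℕ-injective))))

      off : ∀ i j → j ≢ suc m → shear t A i j ≈ shear t′ A i j
      off i zero    j≢ = refl
      off i (suc k) j≢ =
        +-congˡ (*-congʳ (sym (≡⇒≈ (updateAt-minimal k m t (j≢ ∘ ≡.cong suc)))))

      at : ∀ i → shear t A i (suc m) ≈ shear t′ A i (suc m) + t m * shear t′ A i (inject₁ m)
      at i = sym (+-cong
        (shear-fixes t′ A i (suc m) λ { k ≡.refl → t′≈0 k ℕ.≤-refl })
        (*-congˡ (shear-fixes t′ A i (inject₁ m) λ k eq →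
          t′≈0 k (ℕ.≤-trans (ℕ.≤-reflexive (≡.trans (≡.cong toℕ eq) (toℕ-inject₁ m)))
                            (ℕ.n≤1+n _)))))

  det-clearedRow : ∀ {n} (A : Matrix (suc n)) → (∀ j → A zero (suc j) ≈ 0#) →
                   det A ≈ A zero zero * det (λ i j → A (suc i) (suc j))
  det-clearedRow {n} A A₀≈0 = begin
    det A
      ≈⟨ +-cong (*-congʳ (*-identityˡ _)) (∑-cong λ j →
           trans (*-congʳ (trans (*-congˡ (A₀≈0 j)) (zeroʳ _))) (zeroˡ _)) ⟩
    A zero zero * det (λ i j → A (suc i) (suc j)) + ∑ {n} (λ _ → 0#)
      ≈⟨ +-congˡ (sum-replicate-zero n) ⟩
    A zero zero * det (λ i j → A (suc i) (suc j)) + 0#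
      ≈⟨ +-identityʳ _ ⟩
    A zero zero * det (λ i j → A (suc i) (suc j)) ∎

  -- Finite products and powers.

  -- `∏` splits off its first factor, whereas Pochhammer symbols grow at the last one.
  ∏-snoc : ∀ (f : ℕ → Carrier) m →
           ∏ (λ (k : Fin (suc m)) → f (toℕ k)) ≈ ∏ (λ (k : Fin m) → f (toℕ k)) * f m
  ∏-snoc f m = trans (∏-init-last {m} (f ∘ toℕ))
    (*-cong (∏-cong {m} λ k → ≡⇒≈ (≡.cong f (toℕ-inject₁ k))) (≡⇒≈ (≡.cong f (toℕ-fromℕ m))))

  ∏-powers : ∀ x n → ∏ (λ (j : Fin n) → x ^ toℕ j) ≈ x ^ (n C 2)
  ∏-powers x zero    = refl
  ∏-powers x (suc n) = begin
    ∏ (λ (j : Fin (suc n)) → x ^ toℕ j)   ≈⟨ ∏-snoc (x ^_) n ⟩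
    ∏ (λ (j : Fin n) → x ^ toℕ j) * x ^ n ≈⟨ *-comm _ _ ⟩
    x ^ n * ∏ (λ (j : Fin n) → x ^ toℕ j) ≈⟨ *-congˡ (∏-powers x n) ⟩
    x ^ n * x ^ (n C 2)                   ≈⟨ ^-homo-* x n (n C 2) ⟨
    x ^ (n ℕ.+ n C 2)                     ≈⟨ ^-congʳ x (n+nC2≡[1+n]C2 n) ⟩
    x ^ (suc n C 2)                       ∎

  -- Reciprocals and Pochhammer symbols.

  recip : ∀ {x} → x # 0# → Carrier
  recip x#0 = proj₁ (#⇒invertible x#0)

  recip-inverse : ∀ {x} (x#0 : x # 0#) → x * recip x#0 ≈ 1#
  recip-inverse x#0 =
    trans (*-congʳ (sym (x-0≈x _))) (proj₂ (proj₂ (#⇒invertible x#0)))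

  -- `recip` takes its value from an apartness proof; uniqueness of inverses makes that choice
  -- immaterial and underlies the identities between reciprocals below.
  recip-unique : ∀ {x y} (x#0 : x # 0#) → x * y ≈ 1# → recip x#0 ≈ y
  recip-unique {x} {y} x#0 xy≈1 = begin
    recip x#0           ≈⟨ *-identityʳ _ ⟨
    recip x#0 * 1#      ≈⟨ *-congˡ xy≈1 ⟨
    recip x#0 * (x * y) ≈⟨ solve 3 (λ r x y → r :* (x :* y) := x :* r :* y) refl _ _ _ ⟩
    x * recip x#0 * y   ≈⟨ *-congʳ (recip-inverse x#0) ⟩
    1# * y              ≈⟨ *-identityˡ y ⟩
    y                   ∎

  recip-* : ∀ {x y z} (x#0 : x # 0#) (y#0 : y # 0#) (z#0 : z # 0#) → z ≈ x * y →
            recip z#0 ≈ recip x#0 * recip y#0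
  recip-* {x} {y} {z} x#0 y#0 z#0 z≈xy = recip-unique z#0 (begin
    z * (recip x#0 * recip y#0)           ≈⟨ *-congʳ z≈xy ⟩
    x * y * (recip x#0 * recip y#0)       ≈⟨ solve 4 (λ x y r s →
                                               x :* y :* (r :* s) := x :* r :* (y :* s))
                                               refl _ _ _ _ ⟩
    x * recip x#0 * (y * recip y#0)       ≈⟨ *-cong (recip-inverse x#0) (recip-inverse y#0) ⟩
    1# * 1#                               ≈⟨ *-identityˡ 1# ⟩
    1#                                    ∎)

  recip-1 : (1#0 : 1# # 0#) → recip 1#0 ≈ 1#
  recip-1 1#0 = recip-unique 1#0 (*-identityˡ 1#)

  pochhammer-1 : ∀ γ → pochhammer γ 1 ≈ γ
  pochhammer-1 γ = trans (*-identityˡ _) (+-identityʳ γ)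

  pochhammer-+ : ∀ γ m k →
                 pochhammer γ (m ℕ.+ k) ≈ pochhammer γ m * pochhammer (fromℕ m + γ) k
  pochhammer-+ γ m zero rewrite ℕ.+-identityʳ m = sym (*-identityʳ _)
  pochhammer-+ γ m (suc k) rewrite ℕ.+-suc m k = begin
    pochhammer γ (m ℕ.+ k) * (γ + fromℕ (m ℕ.+ k))
      ≈⟨ *-cong (pochhammer-+ γ m k) (+-congˡ (×-homo-+ 1# m k)) ⟩
    pochhammer γ m * pochhammer (fromℕ m + γ) k * (γ + (fromℕ m + fromℕ k))
      ≈⟨ solve 5 (λ p q g m k →
           p :* q :* (g :+ (m :+ k)) := p :* (q :* (m :+ g :+ k))) refl _ _ _ _ _ ⟩
    pochhammer γ m * (pochhammer (fromℕ m + γ) k * (fromℕ m + γ + fromℕ k)) ∎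

  recip-pochhammer-+ : ∀ {γ} (γ∉ : NotNonPositiveInteger γ) m k →
    recip (pochhammer#0 γ∉ (m ℕ.+ k)) ≈
    recip (pochhammer#0 γ∉ m) * recip (pochhammer#0 (shift∉ γ∉ m) k)
  recip-pochhammer-+ γ∉ m k = recip-* _ _ _ (pochhammer-+ _ m k)

  recip-factor : ∀ {γ} → NotNonPositiveInteger γ → ℕ → Carrier
  recip-factor γ∉ k = recip (x#-y⇒x+y#0 (γ∉ k))

  recip-pochhammer-suc : ∀ {γ} (γ∉ : NotNonPositiveInteger γ) k →
    recip (pochhammer#0 γ∉ (suc k)) ≈ recip (pochhammer#0 γ∉ k) * recip-factor γ∉ k
  recip-pochhammer-suc γ∉ k = recip-* _ _ _ refl

  -- Multiplies the column factors 1/(b₀+k) of the elimination into the denominator belonging to the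
  -- top row.
  ∏-recip-factor : ∀ {γ} (γ∉ : NotNonPositiveInteger γ) m →
    ∏ (λ (k : Fin m) → recip-factor γ∉ (toℕ k)) ≈ recip (pochhammer#0 γ∉ m)
  ∏-recip-factor γ∉ zero    = sym (recip-1 _)
  ∏-recip-factor γ∉ (suc m) = trans (∏-snoc (recip-factor γ∉) m)
    (trans (*-congʳ (∏-recip-factor γ∉ m)) (sym (recip-pochhammer-suc γ∉ m)))

  -- The sequence of the theorem for `a₀` and `ρ` equal to 1.
  ratio : Carrier → ∀ {β} → NotNonPositiveInteger β → ℕ → Carrier
  ratio α {β} β∉ m = pochhammer α m / pochhammer β m [ pochhammer#0 β∉ m ]

  ratio-+ : ∀ α {β} (β∉ : NotNonPositiveInteger β) m k →
            ratio α β∉ (m ℕ.+ k) ≈ ratio α β∉ m * ratio (fromℕ m + α) (shift∉ β∉ m) k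
  ratio-+ α β∉ m k = trans
    (*-cong (pochhammer-+ α m k) (recip-pochhammer-+ β∉ m k))
    (solve 4 (λ p q r s → p :* q :* (r :* s) := p :* r :* (q :* s)) refl _ _ _ _)

  -- Elimination in the matrix of ratios.

  x≈y+z⇒x-z≈y : ∀ {x y z} → x ≈ y + z → x - z ≈ y
  x≈y+z⇒x-z≈y x≈y+z = sym (x≈z//y _ _ _ (sym x≈y+z))

  x+[y-x]≈y : ∀ x y → x + (y - x) ≈ y
  x+[y-x]≈y x y = trans (+-comm x (y - x)) (//-rightDividesˡ x y)

  -- d stands for a - a₀ = b - b₀; with a = a₀ + d, b₀ = a₀ + δ and
  -- b = a₀ + δ + d this is a semiring identity.
  cross-product : ∀ {δ a₀ b₀ a b d} k → a₀ + δ ≈ b₀ → a + δ ≈ b → b₀ + d ≈ b →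
                  (a + k) * (b₀ + k) ≈ δ * d + (a₀ + k) * (b + k)
  cross-product {δ} {a₀} {b₀} {a} {b} {d} k a₀+δ≈b₀ a+δ≈b b₀+d≈b = begin
    (a + k) * (b₀ + k)
      ≈⟨ *-cong (+-congʳ a≈) (+-congʳ (sym a₀+δ≈b₀)) ⟩
    (a₀ + d + k) * (a₀ + δ + k)
      ≈⟨ solve 4 (λ a₀ d δ k →
           (a₀ :+ d :+ k) :* (a₀ :+ δ :+ k) :=
           δ :* d :+ (a₀ :+ k) :* (a₀ :+ δ :+ d :+ k)) refl a₀ d δ k ⟩
    δ * d + (a₀ + k) * (a₀ + δ + d + k)
      ≈⟨ +-congˡ (*-congˡ (+-congʳ (trans (+-congʳ a₀+δ≈b₀) b₀+d≈b))) ⟩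
    δ * d + (a₀ + k) * (b + k) ∎
    where
    a≈ : a ≈ a₀ + d
    a≈ = +-cancelʳ δ a (a₀ + d) (begin
      a + δ        ≈⟨ a+δ≈b ⟩
      b            ≈⟨ b₀+d≈b ⟨
      b₀ + d       ≈⟨ +-congʳ a₀+δ≈b₀ ⟨
      a₀ + δ + d   ≈⟨ solve 3 (λ x y z → x :+ y :+ z := x :+ z :+ y) refl a₀ δ d ⟩
      a₀ + d + δ   ∎)

  -- The factor from entry k to entry k+1 of the top row, hence the multiple of column k that clears
  -- entry k+1 there.
  multiplier : Carrier → ∀ {b₀} → NotNonPositiveInteger b₀ → ℕ → Carrier
  multiplier a₀ b₀∉ k = (a₀ + fromℕ k) * recip-factor b₀∉ k

  -- Apart from the common factor (a)ₖ/(b)ₖ, the left side is (a+k)/(b+k) - (a₀+k)/(b₀+k), whose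
  -- numerator is δ(b-b₀) by `cross-product`. The result is grouped as row factor, column factor and
  -- new ratio, the shape `det-scale` expects.
  ratio-eliminate : ∀ {δ a₀ b₀ a b} (b₀∉ : NotNonPositiveInteger b₀)
    (b∉ : NotNonPositiveInteger b) → a₀ + δ ≈ b₀ → a + δ ≈ b → ∀ k →
    ratio a b∉ (suc k) + - multiplier a₀ b₀∉ k * ratio a b∉ k ≈
    (b - b₀) * recip (pochhammer#0 b∉ 1) *
      (δ * recip-factor b₀∉ k * ratio a (shift∉ b∉ 1) k)
  ratio-eliminate {δ} {a₀} {b₀} {a} {b} b₀∉ b∉ a₀+δ≈b₀ a+δ≈b k =
    trans (+-congˡ (sym (-‿distribˡ-* _ _))) (x≈y+z⇒x-z≈y (begin
      P * (a + k′) * recip (pochhammer#0 b∉ (suc k))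
        ≈⟨ *-congˡ (recip-pochhammer-suc b∉ k) ⟩
      P * (a + k′) * (I * J)
        -- The inserted factor `(b₀ + k′) * J₀` equals 1 and supplies the denominator of the
        -- multiplier, so that `cross-product` applies.
        ≈⟨ trans (sym (*-identityʳ _)) (*-congˡ (sym (recip-inverse _))) ⟩
      P * (a + k′) * (I * J) * ((b₀ + k′) * J₀)
        ≈⟨ solve 6 (λ P x I J y J₀ →
             P :* x :* (I :* J) :* (y :* J₀) := x :* y :* (P :* (I :* J) :* J₀))
             refl _ _ _ _ _ _ ⟩
      (a + k′) * (b₀ + k′) * (P * (I * J) * J₀)
        ≈⟨ *-congʳ (cross-product k′ a₀+δ≈b₀ a+δ≈b (x+[y-x]≈y b₀ b)) ⟩
      (δ * (b - b₀) + (a₀ + k′) * (b + k′)) * (P * (I * J) * J₀)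
        ≈⟨ solve 8 (λ δ d x y P I J J₀ →
             (δ :* d :+ x :* y) :* (P :* (I :* J) :* J₀) :=
             δ :* d :* P :* J₀ :* (I :* J) :+ x :* J₀ :* (P :* I) :* (y :* J))
             refl δ (b - b₀) (a₀ + k′) (b + k′) P I J J₀ ⟩
      δ * (b - b₀) * P * J₀ * (I * J) + (a₀ + k′) * J₀ * (P * I) * ((b + k′) * J)
        ≈⟨ +-cong (*-congˡ IJ≈) (trans (*-congˡ (recip-inverse _)) (*-identityʳ _)) ⟩
      δ * (b - b₀) * P * J₀ * (R * S) + (a₀ + k′) * J₀ * (P * I)
        ≈⟨ +-congʳ (solve 6 (λ δ d P J₀ R S →
             δ :* d :* P :* J₀ :* (R :* S) := d :* R :* (δ :* J₀ :* (P :* S)))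
             refl δ (b - b₀) P J₀ R S) ⟩
      (b - b₀) * R * (δ * J₀ * (P * S)) + (a₀ + k′) * J₀ * (P * I) ∎))
    where
    k′ = fromℕ k
    P  = pochhammer a k
    I  = recip (pochhammer#0 b∉ k)
    J  = recip-factor b∉ k
    J₀ = recip-factor b₀∉ k
    R  = recip (pochhammer#0 b∉ 1)
    S  = recip (pochhammer#0 (shift∉ b∉ 1) k)

    -- Both sides are 1/(b)ₖ₊₁, with the last factor split off on the left and the first on the
    -- right.
    IJ≈ : I * J ≈ R * S
    IJ≈ = trans (sym (recip-pochhammer-suc b∉ k)) (recip-pochhammer-+ b∉ 1 k)

  -- Vandermonde products.

  vandermonde : ∀ {n} → (Fin n → Carrier) → Carrier
  vandermonde b = ∏ λ j → ∏ λ (i : Fin′ j) → b j - b (inject i)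

  -- The inner product at index 0 is empty, and each later one begins with its difference to
  -- `b zero`.
  vandermonde-suc : ∀ {n} (b : Fin (suc n) → Carrier) →
    vandermonde b ≈ ∏ (λ j → b (suc j) - b zero) * vandermonde (b ∘ suc)
  vandermonde-suc b = trans (*-identityˡ _) (∏-distrib-* (λ j → b (suc j) - b zero) _)

  -- Assumes only equal differences, so that it applies to translated nodes.
  vandermonde-cong : ∀ {n} {b d : Fin n → Carrier} →
                     (∀ i j → b j - b i ≈ d j - d i) → vandermonde b ≈ vandermonde d
  vandermonde-cong b≈d = ∏-cong λ j → ∏-cong {toℕ j} λ i → b≈d (inject i) j

  [x+y]-[x+z]≈y-z : ∀ x y z → (x + y) - (x + z) ≈ y - z
  [x+y]-[x+z]≈y-z x y z = x≈y+z⇒x-z≈y (begin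
    x + y              ≈⟨ +-congˡ (x+[y-x]≈y z y) ⟨
    x + (z + (y - z))  ≈⟨ solve 3 (λ x z w → x :+ (z :+ w) := w :+ (x :+ z)) refl x z (y - z) ⟩
    y - z + (x + z)    ∎)

  regroup : ∀ d r e f p v w →
            d * r * (e * f) * (p * v * w) ≈ e * p * (d * v) * (f * (r * w))
  regroup = solve 7 (λ d r e f p v w →
    d :* r :* (e :* f) :* (p :* v :* w) := e :* p :* (d :* v) :* (f :* (r :* w))) refl

  -- The determinant of Pochhammer ratios.

  -- Induction on the size: the minor has the same form with `a` kept and with `b` and `δ` raised by
  -- 1. Hence `δ` is a parameter tied to `a` and `b` by an equation.
  det-ratio : ∀ n {δ} {a b : Fin n → Carrier} (b∉ : ∀ i → NotNonPositiveInteger (b i)) →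
    (∀ i → a i + δ ≈ b i) →
    det (λ i j → ratio (a i) (b∉ i) (toℕ j)) ≈
      ∏ (λ (i : Fin n) → pochhammer δ (toℕ i)) * vandermonde b *
      ∏ (λ i → recip (pochhammer#0 (b∉ i) (n ℕ.∸ 1)))
  det-ratio zero b∉ a+δ≈b = sym (trans (*-identityʳ _) (*-identityʳ _))
  det-ratio (suc m) {δ} {a} {b} b∉ a+δ≈b = begin
    det M
      ≈⟨ det-shear t M ⟨
    det (shear t M)
      -- In the top row the row factor contains `b zero - b zero`, so every entry after the first
      -- vanishes.
      ≈⟨ det-clearedRow (shear t M) (λ k → trans (entry zero k)
           (trans (*-congʳ (trans (*-congʳ (-‿inverseʳ _)) (zeroˡ _))) (zeroˡ _))) ⟩
    M zero zero * det (λ i k → shear t M (suc i) (suc k))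
      ≈⟨ *-cong (trans (*-identityˡ _) (recip-1 _)) (det-cong λ i k → entry (suc i) k) ⟩
    1# * det (λ i k → u i * (v k * M′ i k))
      ≈⟨ trans (*-identityˡ _) (det-scale u v M′) ⟩
    ∏ u * ∏ v * det M′
      ≈⟨ *-cong (*-cong rows columns) minors ⟩
    D * R * (δᵐ * W₀) * (Π * V * W)
      ≈⟨ regroup D R δᵐ W₀ Π V W ⟩
    δᵐ * Π * (D * V) * (W₀ * (R * W))
      ≈⟨ *-cong (*-cong pochhammers (sym (vandermonde-suc b))) (*-congˡ denominators) ⟩
    ∏ (λ (i : Fin (suc m)) → pochhammer δ (toℕ i)) * vandermonde b *
      ∏ (λ i → recip (pochhammer#0 (b∉ i) m)) ∎
    where
    M : Matrix (suc m)
    M i j = ratio (a i) (b∉ i) (toℕ j)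

    M′ : Matrix m
    M′ i j = ratio (a (suc i)) (shift∉ (b∉ (suc i)) 1) (toℕ j)

    t u v : Fin m → Carrier
    t k = - multiplier (a zero) (b∉ zero) (toℕ k)
    u i = (b (suc i) - b zero) * recip (pochhammer#0 (b∉ (suc i)) 1)
    v k = δ * recip-factor (b∉ zero) (toℕ k)

    entry : ∀ i k → shear t M i (suc k) ≈
      (b i - b zero) * recip (pochhammer#0 (b∉ i) 1) *
        (v k * ratio (a i) (shift∉ (b∉ i) 1) (toℕ k))
    entry i k = trans
      (+-congˡ (*-congˡ (≡⇒≈ (≡.cong (ratio (a i) (b∉ i)) (toℕ-inject₁ k)))))
      (ratio-eliminate (b∉ zero) (b∉ i) (a+δ≈b zero) (a+δ≈b i) (toℕ k))

    shifted : ∀ i → a (suc i) + (fromℕ 1 + δ) ≈ fromℕ 1 + b (suc i)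
    shifted i = trans (solve 3 (λ a e δ → a :+ (e :+ δ) := e :+ (a :+ δ)) refl _ _ _)
                      (+-congˡ (a+δ≈b (suc i)))

    -- `D` completes the Vandermonde product, `δᵐ` turns each (1+δ)ᵢ into (δ)ᵢ₊₁, `W₀` is the
    -- denominator of the top row, and `R` completes those of the other rows.
    D  = ∏ λ i → b (suc i) - b zero
    r  = λ i → recip (pochhammer#0 (b∉ (suc i)) 1)
    R  = ∏ r
    δᵐ = ∏ {m} λ _ → δ
    W₀ = recip (pochhammer#0 (b∉ zero) m)
    Π  = ∏ λ (i : Fin m) → pochhammer (fromℕ 1 + δ) (toℕ i)
    V  = vandermonde (b ∘ suc)
    w  = λ i → recip (pochhammer#0 (shift∉ (b∉ (suc i)) 1) (m ℕ.∸ 1))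
    W  = ∏ w

    rows : ∏ u ≈ D * R
    rows = ∏-distrib-* (λ i → b (suc i) - b zero) r

    columns : ∏ v ≈ δᵐ * W₀
    columns = trans (∏-distrib-* {m} (λ _ → δ) (λ k → recip-factor (b∉ zero) (toℕ k)))
                    (*-congˡ (∏-recip-factor (b∉ zero) m))

    minors : det M′ ≈ Π * V * W
    minors = trans (det-ratio m (λ i → shift∉ (b∉ (suc i)) 1) shifted)
      (*-congʳ (*-congˡ (vandermonde-cong {b = λ i → fromℕ 1 + b (suc i)} {b ∘ suc}
        λ i j → [x+y]-[x+z]≈y-z (fromℕ 1) (b (suc j)) (b (suc i)))))

    pochhammers : δᵐ * Π ≈ ∏ (λ (i : Fin (suc m)) → pochhammer δ (toℕ i))
    pochhammers = begin
      δᵐ * Π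
        ≈⟨ ∏-distrib-* (λ (_ : Fin m) → δ) (λ i → pochhammer (fromℕ 1 + δ) (toℕ i)) ⟨
      ∏ (λ (i : Fin m) → δ * pochhammer (fromℕ 1 + δ) (toℕ i))
        ≈⟨ ∏-cong {m} (λ i → trans (*-congʳ (sym (pochhammer-1 δ)))
                                   (sym (pochhammer-+ δ 1 (toℕ i)))) ⟩
      ∏ (λ (i : Fin m) → pochhammer δ (suc (toℕ i)))
        ≈⟨ *-identityˡ _ ⟨
      ∏ (λ (i : Fin (suc m)) → pochhammer δ (toℕ i)) ∎

    denominators : R * W ≈ ∏ (λ i → recip (pochhammer#0 (b∉ (suc i)) m))
    denominators = trans (sym (∏-distrib-* r w)) (∏-cong λ i →
      trans (sym (recip-pochhammer-+ (b∉ (suc i)) 1 (m ℕ.∸ 1)))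
            (≡⇒≈ (≡.cong (λ k → recip (pochhammer#0 (b∉ (suc i)) k)) (1+[m∸1]≡m i))))
      where
      -- An element of `Fin m` rules out m = 0, where the truncated subtraction would break the
      -- equation.
      1+[m∸1]≡m : ∀ {m} → Fin m → 1 ℕ.+ (m ℕ.∸ 1) ≡ m
      1+[m∸1]≡m {suc m} _ = ≡.refl


-- Reduction of the theorem to the determinant of ratios.

theorem4p1 :
  ∀ {c ℓ₁ ℓ₂} (F : HeytingField c ℓ₁ ℓ₂) →
  let open HeytingField F
      open Over F
  in
  (n : ℕ) → 1 ℕ.≤ n →
  (a₀ ρ α β : Carrier) → ρ # 0# →
  (β∉ : NotNonPositiveInteger β) →
  let a : ℕ → Carrier
      a m = a₀ * ρ ^ m * (pochhammer α m / pochhammer β m [ pochhammer#0 β∉ m ])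
  in
  (x : Fin n → ℕ) → (∀ {i j} → i Fin.< j → x i ℕ.< x j) →
  det (λ (i j : Fin n) → a (x i ℕ.+ toℕ j))
    ≈ ρ ^ (n C 2)
      * ∏ (λ (i : Fin n) → pochhammer (β - α) (toℕ i))
      * ∏ (λ (j : Fin n) → ∏ (λ (i : Fin′ j) → fromℕ (x j) - fromℕ (x (inject i))))
      * ∏ (λ (i : Fin n) →
          a (x i) / pochhammer (fromℕ (x i) + β) (n ℕ.∸ 1)
            [ pochhammer#0 (shift∉ β∉ (x i)) (n ℕ.∸ 1) ])
theorem4p1 F n 1≤n a₀ ρ α β ρ#0 β∉ x x-increasing = begin
  det (λ i j → a (x i ℕ.+ toℕ j))
    ≈⟨ det-cong F (λ i j → entry (x i) (toℕ j)) ⟩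
  det (λ i (j : Fin n) → a (x i) * (ρ ^ toℕ j * q i j))
    ≈⟨ det-scale F (λ i → a (x i)) (λ j → ρ ^ toℕ j) q ⟩
  A * ∏ (λ (j : Fin n) → ρ ^ toℕ j) * det q
    ≈⟨ *-cong (*-congˡ (∏-powers F ρ n)) (det-ratio F n (λ i → shift∉ β∉ (x i)) shifted) ⟩
  A * ρ ^ (n C 2) * (P * vandermonde F (λ i → fromℕ (x i) + β) * W)
    -- The common shift by β cancels from the differences of the nodes.
    ≈⟨ *-congˡ (*-congʳ (*-congˡ (vandermonde-cong F differences))) ⟩
  A * ρ ^ (n C 2) * (P * V * W)
    ≈⟨ solve 5 (λ A r P V W → A :* r :* (P :* V :* W) := r :* P :* V :* (A :* W))
         refl A (ρ ^ (n C 2)) P V W ⟩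
  ρ ^ (n C 2) * P * V * (A * W)
    ≈⟨ *-congˡ (∏-distrib-* (λ i → a (x i)) _) ⟨
  ρ ^ (n C 2) * P * V *
    ∏ (λ i → a (x i) / pochhammer (fromℕ (x i) + β) (n ℕ.∸ 1)
               [ pochhammer#0 (shift∉ β∉ (x i)) (n ℕ.∸ 1) ]) ∎
  where
  open HeytingField F
  open Over F
  open HeytingCommutativeRing heytingCommutativeRing using (commutativeRing)
  open CommutativeRing commutativeRing
    using (semiring; commutativeSemiring; *-commutativeMonoid)
  open Algebra.Properties.Semiring.Exp semiring using (^-homo-*)
  open Algebra.Properties.CommutativeMonoid.Sum *-commutativeMonoid
    using () renaming (∑-distrib-+ to ∏-distrib-*)
  open Algebra.Solver.Ring.NaturalCoefficients.Default commutativeSemiring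
    using (solve; _:=_; _:+_; _:*_)
  open Relation.Binary.Reasoning.Setoid setoid

  a : ℕ → Carrier
  a m = a₀ * ρ ^ m * ratio F α β∉ m

  q : Fin n → Fin n → Carrier
  q i j = ratio F (fromℕ (x i) + α) (shift∉ β∉ (x i)) (toℕ j)

  A = ∏ λ i → a (x i)
  P = ∏ λ (i : Fin n) → pochhammer (β - α) (toℕ i)
  V = vandermonde F λ i → fromℕ (x i)
  W = ∏ λ i → recip F (pochhammer#0 (shift∉ β∉ (x i)) (n ℕ.∸ 1))

  entry : ∀ m k →
    a (m ℕ.+ k) ≈ a m * (ρ ^ k * ratio F (fromℕ m + α) (shift∉ β∉ m) k)
  entry m k = trans (*-cong (*-congˡ (^-homo-* ρ m k)) (ratio-+ F α β∉ m k))
    (solve 5 (λ a₀ r s p q → a₀ :* (r :* s) :* (p :* q) := a₀ :* r :* p :* (s :* q))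
      refl _ _ _ _ _)

  shifted : ∀ i → fromℕ (x i) + α + (β - α) ≈ fromℕ (x i) + β
  shifted i = trans (+-assoc _ _ _) (+-congˡ (x+[y-x]≈y F α β))

  differences : ∀ i j →
    (fromℕ (x j) + β) - (fromℕ (x i) + β) ≈ fromℕ (x j) - fromℕ (x i)
  differences i j = trans (+-cong (+-comm _ _) (-‿cong (+-comm _ _)))
    ([x+y]-[x+z]≈y-z F β (fromℕ (x j)) (fromℕ (x i)))
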